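{- Let $m\ge1$ and let $\tau,\tau'\in S_{m+1}$ be permutations without self-overlaps such that $\tau(1)=\tau'(1)$ and $\tau(m+1)=\tau'(m+1)$. Then for every $n$ and every $k$, the number of permutations of length $n$ with exactly $k$ occurrences of $\tau$ equals the number of permutations of length $n$ with exactly $k$ occurrences of $\tau'$. (That is, for non-self-overlapping patterns of length $m+1$, this number depends only on $m$, $\tau(1)$ and $\tau(m+1)$.)
   Context: A permutation of length $n$ is a sequence containing each of $1,\dots,n$ exactly once; $S_n$ is the set of these. For a sequence $s$ of distinct integers, $\mathrm{st}(s)$ is the unique permutation with the same relative order of entries. An occurrence of $\tau$ in $\sigma$ (as a consecutive pattern) is a segment $\sigma_i\cdots\sigma_j$ with $\mathrm{st}(\sigma_i\cdots\sigma_j)=\tau$. A pattern $\tau\in S_{m+1}$ has no self-overlaps if every permutation of length at most $2m$ has at most one occurrence of $\tau$. -}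

module Defs where

open import Data.Nat using (ℕ; zero; suc; _≡ᵇ_; _<ᵇ_; _≤_; _*_; _≟_)
open import Data.Bool using (Bool; _∧_; T)
open import Data.List using (List; []; _∷_; [_]; length; map; concatMap; filter; filterᵇ; applyUpTo; take)
open import Data.Bool.ListAction using (all)
import Data.List.Properties as LP
open import Relation.Binary.PropositionalEquality using (_≡_)

range : ℕ → List ℕ
range n = applyUpTo suc n

mult : ℕ → List ℕ → ℕ
mult x s = length (filterᵇ (_≡ᵇ x) s)

isPerm : ℕ → List ℕ → Bool
isPerm n s = (length s ≡ᵇ n) ∧ all (λ i → mult i s ≡ᵇ 1) (range n)

IsPerm : ℕ → List ℕ → Set
IsPerm n s = T (isPerm n s)

words : ℕ → ℕ → List (List ℕ)
words n zero    = [ [] ]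
words n (suc l) = concatMap (λ x → map (x ∷_) (words n l)) (range n)

perms : ℕ → List (List ℕ)
perms n = filterᵇ (isPerm n) (words n n)

st : List ℕ → List ℕ
st s = map (λ x → suc (length (filterᵇ (_<ᵇ x) s))) s

suffixes : List ℕ → List (List ℕ)
suffixes []       = [ [] ]
suffixes (x ∷ xs) = (x ∷ xs) ∷ suffixes xs

windows : ℕ → List ℕ → List (List ℕ)
windows k s = filterᵇ (λ w → length w ≡ᵇ k) (map (take k) (suffixes s))

occ : List ℕ → List ℕ → ℕ
occ τ σ = length (filter (λ w → LP.≡-dec _≟_ (st w) τ) (windows (length τ) σ))

-- τ ∈ S_{m+1} has no self-overlaps: every permutation of length ≤ 2m
-- has at most one occurrence of τ
NoSelfOverlaps : ℕ → List ℕ → Set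
NoSelfOverlaps m τ = ∀ (σ : List ℕ) → IsPerm (length σ) σ → length σ ≤ 2 * m → occ τ σ ≤ 1

numExact : ℕ → List ℕ → ℕ → ℕ
numExact n τ k = length (filter (λ σ → occ τ σ ≟ k) (perms n))

{-# OPTIONS --safe #-}
module Submission where

-- Mark a set S of occurrences of τ. Without self-overlaps two marked windows share at most an
-- endpoint of each, so the entries of the marked windows can be rearranged one window at a time
-- from the pattern τ to τ′: as τ and τ′ agree in their first and last entries, the other marked
-- windows do not change. Hence, for each S, as many permutations have τ as have τ′ at all positions
-- of S. By inclusion–exclusion the numbers of permutations with exactly k occurrences agree too.

open import Defs
open import Data.Bool using (true; false; T; T?)
open import Data.Bool.Properties using (T-∧)
open import Data.List
  using (List; []; _∷_; [_]; _++_; _∷ʳ_; map; length; filter; filterᵇ; take; drop; head; last;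
         applyUpTo; upTo; concatMap; cartesianProductWith; initLast; _∷ʳ′_)
open import Data.List.Properties as List
  using (filter-accept; filter-reject; filter-none; filter-notAll; length-filter;
         length-map; map-∘; map-++; map-cong-local; map-id-local; ++-assoc; length-++;
         take-map; drop-map; take-take; take-drop; drop-drop; length-take; length-drop;
         take++drop≡id; length-applyUpTo)
open import Data.List.Membership.Propositional using (_∈_)
open import Data.List.Membership.Propositional.Properties
  using (∈-∃++; ∈-++⁻; ∈-filter⁺; ∈-filter⁻; ∈-map⁺; ∈-map⁻; ∈-upTo⁺; ∈-applyUpTo⁺;
         ∈-cartesianProductWith⁺)
open import Data.List.Relation.Binary.Permutation.Propositional
  using (_↭_; ↭-refl; ↭-sym; ↭-trans; ↭⇒↭ₛ; ↭-reflexive)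
open import Data.List.Relation.Binary.Permutation.Propositional.Properties
  using (shift; ↭-length; filter-↭; ∈-resp-↭; ++⁺ˡ; ++⁺ʳ; ++-identityʳ)
  renaming (map⁺ to ↭-map⁺)
open import Data.List.Relation.Binary.Permutation.Setoid.Properties
  using (AllPairs-resp-↭; Unique-resp-↭)
open import Data.List.Relation.Binary.Subset.Propositional using (_⊆_)
open import Data.List.Relation.Unary.All as All using (All; []; _∷_; all?)
import Data.List.Relation.Unary.All.Properties as All
open import Data.List.Relation.Unary.AllPairs as AllPairs using (AllPairs; []; _∷_; allPairs?)
open import Data.List.Relation.Unary.Any as Any using (here; there)
open import Data.List.Relation.Unary.Unique.Propositional using (Unique)
import Data.List.Relation.Unary.Unique.Propositional.Properties as Unique
open import Data.Maybe using (just)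
open import Data.Maybe.Properties using (just-injective)
open import Data.Nat
  using (ℕ; zero; suc; _+_; _*_; _∸_; _⊓_; _≤_; _<_; _≤?_; _≟_; _<ᵇ_; _≡ᵇ_; z≤n; s≤s)
open import Data.Nat.Properties
open import Data.Product using (_×_; _,_; ∃; proj₁; proj₂)
open import Data.Sum using (_⊎_; inj₁; inj₂; swap)
open import Function using (_∘_; id; _⇔_; mk⇔; Equivalence)
open import Relation.Binary.Definitions using (tri<; tri≈; tri>)
open import Relation.Binary.PropositionalEquality hiding ([_])
open import Relation.Nullary using (¬_; Dec; yes; no; does; contradiction)
open import Relation.Nullary.Decidable using (_×-dec_; _⊎-dec_; ¬?; does-⇔)
open import Relation.Unary using (Decidable)

-- Lists without repetitions

-- Basis of the pigeonhole arguments below. The tail is split off first; since `x` does not recur in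
-- the tail, its occurrence in `ys` lies in the remainder `zs`.
unique⊆⇒++ : {A : Set} {xs ys : List A} → Unique xs → xs ⊆ ys → ∃ λ zs → ys ↭ xs ++ zs
unique⊆⇒++ [] _ = _ , ↭-refl
unique⊆⇒++ {xs = x ∷ xs} (x∉xs ∷ uxs) sub
  with zs , ys↭ ← unique⊆⇒++ uxs (sub ∘ there)
  with ∈-++⁻ xs (∈-resp-↭ ys↭ (sub (here refl)))
... | inj₁ x∈xs = contradiction refl (All.lookup x∉xs x∈xs)
... | inj₂ x∈zs with as , bs , refl ← ∈-∃++ x∈zs =
  as ++ bs , ↭-trans ys↭ (↭-trans (++⁺ˡ xs (shift x as bs)) (shift x xs (as ++ bs)))

unique⊆⇒length≤ : {A : Set} {xs ys : List A} → Unique xs → xs ⊆ ys → length xs ≤ length ys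
unique⊆⇒length≤ {xs = xs} uxs sub with zs , ys↭ ← unique⊆⇒++ uxs sub =
  subst (length xs ≤_) (sym (trans (↭-length ys↭) (length-++ xs))) (m≤m+n _ _)

unique⊆⇒↭ : {A : Set} {xs ys : List A} →
  Unique xs → xs ⊆ ys → length ys ≤ length xs → ys ↭ xs
unique⊆⇒↭ {xs = xs} {ys} uxs sub len with unique⊆⇒++ uxs sub
... | [] , ys↭ = ↭-trans ys↭ (++-identityʳ xs)
... | z ∷ zs , ys↭ = contradiction len (<⇒≱ (subst (length xs <_)
  (sym (trans (↭-length ys↭) (trans (length-++ xs) (+-suc _ _)))) (s≤s (m≤m+n _ _))))

unique-↭ : {A : Set} {xs ys : List A} → xs ↭ ys → Unique xs → Unique ys
unique-↭ p = Unique-resp-↭ (setoid _) (↭⇒↭ₛ p)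

-- Counting

count : {A : Set} {P : A → Set} → Decidable P → List A → ℕ
count P? xs = length (filter P? xs)

module _ {A : Set} {P Q : A → Set} (P? : Decidable P) (Q? : Decidable Q) where

  filter-cong-local : ∀ {xs} → All (λ x → P x ⇔ Q x) xs → filter P? xs ≡ filter Q? xs
  filter-cong-local [] = refl
  filter-cong-local {x ∷ xs} (e ∷ es)
    with does (P? x) | does (Q? x) | does-⇔ e (P? x) (Q? x)
  ... | true  | true  | _ = cong (x ∷_) (filter-cong-local es)
  ... | false | false | _ = filter-cong-local es

  count-cong : ∀ xs → (∀ {x} → P x → Q x) → (∀ {x} → Q x → P x) → count P? xs ≡ count Q? xs
  count-cong xs f g = cong length (filter-cong-local {xs} (All.tabulate λ _ → mk⇔ f g))

  filter-filter : (∀ {x} → P x → Q x) → ∀ xs → filter P? (filter Q? xs) ≡ filter P? xs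
  filter-filter sub [] = refl
  filter-filter sub (x ∷ xs) with Q? x
  ... | no ¬q = trans (filter-filter sub xs) (sym (filter-reject P? (¬q ∘ sub)))
  ... | yes _ with does (P? x)
  ...   | true  = cong (x ∷_) (filter-filter sub xs)
  ...   | false = filter-filter sub xs

  count-split : ∀ xs →
    count P? xs ≡ count (λ x → Q? x ×-dec P? x) xs + count (λ x → ¬? (Q? x) ×-dec P? x) xs
  count-split [] = refl
  count-split (x ∷ xs) with does (Q? x) | does (P? x)
  ... | true  | true  = cong suc (count-split xs)
  ... | true  | false = count-split xs
  ... | false | false = count-split xs
  ... | false | true  = trans (cong suc (count-split xs)) (sym (+-suc _ _))

count-none : {A : Set} {P : A → Set} (P? : Decidable P) → ∀ xs →
  (∀ {x} → x ∈ xs → ¬ P x) → count P? xs ≡ 0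
count-none P? xs ¬P = cong length (filter-none P? (All.tabulate ¬P))

count-map : {A B : Set} {P : B → Set} (P? : Decidable P) (f : A → B) → ∀ xs →
  count P? (map f xs) ≡ count (P? ∘ f) xs
count-map P? f [] = refl
count-map P? f (x ∷ xs) with does (P? (f x))
... | true  = cong suc (count-map P? f xs)
... | false = count-map P? f xs

-- The left inverse `g`, needed only on elements satisfying `P`, makes `f` injective there: every
-- such element is `g` of some element satisfying `Q`, so the pigeonhole bound applies to the image
-- under `g`.
count-≤ : {A : Set} {P Q : A → Set} (P? : Decidable P) (Q? : Decidable Q) → ∀ {xs} →
  Unique xs → (f g : A → A) →
  (∀ {x} → x ∈ xs → P x → f x ∈ xs × Q (f x) × g (f x) ≡ x) →
  count P? xs ≤ count Q? xs
count-≤ P? Q? {xs} uxs f g inj =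
  subst (count P? xs ≤_) (length-map g (filter Q? xs))
    (unique⊆⇒length≤ (Unique.filter⁺ P? uxs) sub)
  where
  sub : filter P? xs ⊆ map g (filter Q? xs)
  sub x∈ with x∈xs , px ← ∈-filter⁻ P? x∈ with fx∈ , qfx , eq ← inj x∈xs px =
    subst (_∈ _) eq (∈-map⁺ g (∈-filter⁺ Q? fx∈ qfx))

-- Inclusion–exclusion

module Hits {I A : Set} {P : I → A → Set} (P? : ∀ i → Decidable (P i)) where

  hits : List I → A → ℕ
  hits is x = count (λ i → P? i x) is

  all-hit? : ∀ is → Decidable (λ x → All (λ i → P i x) is)
  all-hit? is x = all? (λ i → P? i x) is

  module _ {K : ℕ → Set} (K? : Decidable K) where

    -- `S` holds the positions already required to be hit, `is` those still undecided. An arbitrary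
    -- condition `K` on the number of hits, rather than equality with a fixed number, lets a hit be
    -- absorbed by passing to `K? ∘ suc`.
    both? : ∀ S is → Decidable (λ x → All (λ i → P i x) S × K (hits is x))
    both? S is x = all-hit? S x ×-dec K? (hits is x)

  -- Whether i is hit or not is resolved by adding the points where i is hit to both sides.
  both-∷ : {K : ℕ → Set} (K? : Decidable K) → ∀ i is S xs →
    count (both? K? S (i ∷ is)) xs + count (both? K? (i ∷ S) is) xs ≡
    count (both? (K? ∘ suc) (i ∷ S) is) xs + count (both? K? S is) xs
  both-∷ {K} K? i is S xs = begin
    count (both? K? S (i ∷ is)) xs + hit
      ≡⟨ cong (_+ hit) (count-split _ (P? i) xs) ⟩
    (count (λ x → P? i x ×-dec both? K? S (i ∷ is) x) xs
       + count (λ x → ¬? (P? i x) ×-dec both? K? S (i ∷ is) x) xs) + hit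
      ≡⟨ cong (_+ hit) (cong₂ _+_
           (count-cong _ _ xs
             (λ (p , ps , k) → p ∷ ps , subst K (hits-yes p) k)
             (λ { (p ∷ ps , k) → p , ps , subst K (sym (hits-yes p)) k }))
           (count-cong _ (λ x → ¬? (P? i x) ×-dec both? K? S is x) xs
             (λ (¬p , ps , k) → ¬p , ps , subst K (hits-no ¬p) k)
             (λ (¬p , ps , k) → ¬p , ps , subst K (sym (hits-no ¬p)) k))) ⟩
    (hit⁺ + miss) + hit
      ≡⟨ +-assoc hit⁺ miss hit ⟩
    hit⁺ + (miss + hit)
      ≡⟨ cong (hit⁺ +_) (+-comm miss hit) ⟩
    hit⁺ + (hit + miss)
      ≡⟨ cong (λ c → hit⁺ + (c + miss)) (count-cong _ _ xs
           (λ { (p ∷ ps , k) → p , ps , k })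
           (λ (p , ps , k) → p ∷ ps , k)) ⟩
    hit⁺ + (count (λ x → P? i x ×-dec both? K? S is x) xs + miss)
      ≡⟨ cong (hit⁺ +_) (count-split _ (P? i) xs) ⟨
    hit⁺ + count (both? K? S is) xs ∎
    where
    open ≡-Reasoning
    hit  = count (both? K? (i ∷ S) is) xs
    hit⁺ = count (both? (K? ∘ suc) (i ∷ S) is) xs
    miss = count (λ x → ¬? (P? i x) ×-dec both? K? S is x) xs
    hits-yes : ∀ {x} → P i x → hits (i ∷ is) x ≡ suc (hits is x)
    hits-yes {x} p = cong length (filter-accept (λ j → P? j x) p)
    hits-no : ∀ {x} → ¬ P i x → hits (i ∷ is) x ≡ hits is x
    hits-no {x} ¬p = cong length (filter-reject (λ j → P? j x) ¬p)

module _ {I A : Set} {P Q : I → A → Set}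
  (P? : ∀ i → Decidable (P i)) (Q? : ∀ i → Decidable (Q i)) (xs : List A)
  (eq : ∀ S → Unique S → count (Hits.all-hit? P? S) xs ≡ count (Hits.all-hit? Q? S) xs)
  where

  private
    module P = Hits P?
    module Q = Hits Q?

  -- Induction on the undecided positions. Once none is left, the condition on hits is the constant
  -- `K 0`, so `eq` decides the case. `Unique (is ++ S)` is carried along because `eq` speaks only
  -- of `S` without repetitions.
  count-both : {K : ℕ → Set} (K? : Decidable K) → ∀ is S → Unique (is ++ S) →
    count (P.both? K? S is) xs ≡ count (Q.both? K? S is) xs
  count-both {K} K? [] S u = by-cases (K? 0)
    where
    open ≡-Reasoning
    by-cases : Dec (K 0) → count (P.both? K? S []) xs ≡ count (Q.both? K? S []) xs
    by-cases (yes k) = begin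
      count (P.both? K? S []) xs   ≡⟨ count-cong _ _ xs proj₁ (_, k) ⟩
      count (P.all-hit? S) xs      ≡⟨ eq S u ⟩
      count (Q.all-hit? S) xs      ≡⟨ count-cong _ _ xs (_, k) proj₁ ⟩
      count (Q.both? K? S []) xs   ∎
    by-cases (no ¬k) =
      trans (count-none _ xs (λ _ → ¬k ∘ proj₂)) (sym (count-none _ xs (λ _ → ¬k ∘ proj₂)))
  -- Three of the four terms in `both-∷` have the shorter list `is` and agree by induction. The term
  -- with `i ∷ S` and unshifted `K` was added to both sides and is cancelled.
  count-both K? (i ∷ is) S u = +-cancelʳ-≡ _ _ _ (begin
    count (P.both? K? S (i ∷ is)) xs + count (P.both? K? (i ∷ S) is) xs
      ≡⟨ P.both-∷ K? i is S xs ⟩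
    count (P.both? (K? ∘ suc) (i ∷ S) is) xs + count (P.both? K? S is) xs
      ≡⟨ cong₂ _+_ (count-both (K? ∘ suc) is (i ∷ S) u′) (count-both K? is S (AllPairs.tail u)) ⟩
    count (Q.both? (K? ∘ suc) (i ∷ S) is) xs + count (Q.both? K? S is) xs
      ≡⟨ Q.both-∷ K? i is S xs ⟨
    count (Q.both? K? S (i ∷ is)) xs + count (Q.both? K? (i ∷ S) is) xs
      ≡⟨ cong (count (Q.both? K? S (i ∷ is)) xs +_) (count-both K? is (i ∷ S) u′) ⟨
    count (Q.both? K? S (i ∷ is)) xs + count (P.both? K? (i ∷ S) is) xs ∎)
    where
    open ≡-Reasoning
    u′ = unique-↭ (↭-sym (shift i is S)) u

  count-hits : ∀ is → Unique is → ∀ k →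
    count (λ x → P.hits is x ≟ k) xs ≡ count (λ x → Q.hits is x ≟ k) xs
  count-hits is u k = begin
    count (λ x → P.hits is x ≟ k) xs     ≡⟨ count-cong _ _ xs ([] ,_) proj₂ ⟩
    count (P.both? (_≟ k) [] is) xs      ≡⟨ count-both (_≟ k) is [] (subst Unique (sym (List.++-identityʳ is)) u) ⟩
    count (Q.both? (_≟ k) [] is) xs      ≡⟨ count-cong _ _ xs proj₂ ([] ,_) ⟩
    count (λ x → Q.hits is x ≟ k) xs     ∎
    where open ≡-Reasoning

-- Permutations of a range

range-unique : ∀ n → Unique (range n)
range-unique n = Unique.applyUpTo⁺₁ suc n (λ i<j _ → <⇒≢ i<j ∘ suc-injective)

mult-↭ : ∀ x {s t} → s ↭ t → mult x s ≡ mult x t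
mult-↭ x p = ↭-length (filter-↭ (T? ∘ (_≡ᵇ x)) p)

unique⇒mult≡1 : ∀ {x s} → Unique s → x ∈ s → mult x s ≡ 1
unique⇒mult≡1 {x} {y ∷ s} (y∉s ∷ _) (here refl) =
  trans (cong length (filter-accept (T? ∘ (_≡ᵇ x)) {x} {s} (≡⇒≡ᵇ x x refl)))
    (cong suc (count-none (T? ∘ (_≡ᵇ x)) s
      (λ {z} z∈s t → All.lookup y∉s z∈s (sym (≡ᵇ⇒≡ z x t)))))
unique⇒mult≡1 {x} {y ∷ s} (y∉s ∷ us) (there x∈s) =
  trans (cong length (filter-reject (T? ∘ (_≡ᵇ x)) {y} {s}
      (All.lookup y∉s x∈s ∘ ≡ᵇ⇒≡ y x)))
    (unique⇒mult≡1 us x∈s)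

mult≡1⇒∈ : ∀ {x s} → mult x s ≡ 1 → x ∈ s
mult≡1⇒∈ {x} {s} eq with filterᵇ (_≡ᵇ x) s | (λ {y} → ∈-filter⁻ (T? ∘ (_≡ᵇ x)) {y} {s}) | eq
... | y ∷ [] | filter⁻ | _ with y∈s , t ← filter⁻ (here refl) = subst (_∈ s) (≡ᵇ⇒≡ y x t) y∈s

-- Each number of `range n` occurs in `s`, and the lengths agree, so by pigeonhole `s` has no room
-- for anything else.
IsPerm⇒↭ : ∀ n {s} → IsPerm n s → s ↭ range n
IsPerm⇒↭ n {s} p with len , mults ← Equivalence.to T-∧ p =
  unique⊆⇒↭ (range-unique n)
    (λ {i} i∈ → mult≡1⇒∈ (≡ᵇ⇒≡ (mult i s) 1 (All.lookup (All.all⁺ _ (range n) mults) i∈)))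
    (≤-reflexive (trans (≡ᵇ⇒≡ (length s) n len) (sym (length-applyUpTo suc n))))

↭⇒IsPerm : ∀ n {s} → s ↭ range n → IsPerm n s
↭⇒IsPerm n {s} p = Equivalence.from T-∧
  ( ≡⇒≡ᵇ (length s) n (trans (↭-length p) (length-applyUpTo suc n))
  , All.all⁻ _ (All.tabulate λ {i} i∈ →
      ≡⇒≡ᵇ (mult i s) 1 (trans (mult-↭ i p) (unique⇒mult≡1 (range-unique n) i∈))) )

words-suc : ∀ n l → words n (suc l) ≡ cartesianProductWith _∷_ (range n) (words n l)
words-suc n l = go (range n)
  where
  go : ∀ xs → concatMap (λ x → map (x ∷_) (words n l)) xs ≡ cartesianProductWith _∷_ xs (words n l)
  go []       = refl
  go (x ∷ xs) = cong (map (x ∷_) (words n l) ++_) (go xs)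

words-unique : ∀ n l → Unique (words n l)
words-unique n zero = [] ∷ []
words-unique n (suc l) = subst Unique (sym (words-suc n l))
  (Unique.cartesianProductWith⁺ _∷_ List.∷-injective (range-unique n) (words-unique n l))

∈-words : ∀ n {s} → All (_∈ range n) s → s ∈ words n (length s)
∈-words n []                    = here refl
∈-words n {x ∷ s} (x∈ ∷ s∈) = subst (x ∷ s ∈_) (sym (words-suc n (length s)))
  (∈-cartesianProductWith⁺ _∷_ x∈ (∈-words n s∈))

perms-unique : ∀ n → Unique (perms n)
perms-unique n = Unique.filter⁺ _ (words-unique n n)

∈-perms⁺ : ∀ n {s} → s ↭ range n → s ∈ perms n
∈-perms⁺ n {s} p = ∈-filter⁺ (T? ∘ isPerm n)
  (subst (λ l → s ∈ words n l) (trans (↭-length p) (length-applyUpTo suc n))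
    (∈-words n (All.tabulate (∈-resp-↭ p))))
  (↭⇒IsPerm n p)

∈-perms⁻ : ∀ n {s} → s ∈ perms n → s ↭ range n
∈-perms⁻ n s∈ = IsPerm⇒↭ n (proj₂ (∈-filter⁻ (T? ∘ isPerm n) {xs = words n n} s∈))

-- Standardization

rank : List ℕ → ℕ → ℕ
rank s x = suc (length (filterᵇ (_<ᵇ x) s))

length-st : ∀ s → length (st s) ≡ length s
length-st s = length-map (rank s) s

rank-↭ : ∀ {s t} → s ↭ t → ∀ x → rank s x ≡ rank t x
rank-↭ p x = cong suc (↭-length (filter-↭ _ p))

-- Since `x` is not below itself, the filter drops at least one entry, which makes up for the `suc`
-- in `rank`.
rank-≤-length : ∀ {s x} → x ∈ s → rank s x ≤ length s
rank-≤-length {s} {x} x∈s =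
  filter-notAll (T? ∘ (_<ᵇ x)) s (Any.map (λ { refl → <-irrefl refl ∘ <ᵇ⇒< x x }) x∈s)

rank-mono-≤ : ∀ s {x y} → x ≤ y → rank s x ≤ rank s y
rank-mono-≤ s {x} {y} x≤y = s≤s (subst (_≤ length (filterᵇ (_<ᵇ y) s))
  (cong length (filter-filter (T? ∘ (_<ᵇ x)) (T? ∘ (_<ᵇ y)) (λ {z} t → <⇒<ᵇ (<-≤-trans (<ᵇ⇒< z x t) x≤y)) s))
  (length-filter (T? ∘ (_<ᵇ x)) (filterᵇ (_<ᵇ y) s)))

-- Apply `rank-≤-length` to the sublist of entries below `y`: it contains `x`, and `x` has the same
-- rank in it as in `s`.
rank-mono-< : ∀ {s x y} → x ∈ s → x < y → rank s x < rank s y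
rank-mono-< {s} {x} {y} x∈s x<y = s≤s (subst (_≤ length (filterᵇ (_<ᵇ y) s))
  (cong (suc ∘ length) (filter-filter (T? ∘ (_<ᵇ x)) (T? ∘ (_<ᵇ y)) (λ {z} t → <⇒<ᵇ (<-trans (<ᵇ⇒< z x t) x<y)) s))
  (rank-≤-length (∈-filter⁺ (T? ∘ (_<ᵇ y)) x∈s (<⇒<ᵇ x<y))))

rank-cancel-< : ∀ {s x y} → rank s x < rank s y → x < y
rank-cancel-< {s} {x} {y} rx<ry with x <? y
... | yes x<y = x<y
... | no x≮y = contradiction rx<ry (≤⇒≯ (rank-mono-≤ s (≮⇒≥ x≮y)))

rank-injective : ∀ {s x y} → x ∈ s → y ∈ s → rank s x ≡ rank s y → x ≡ y
rank-injective {x = x} {y} x∈s y∈s eq with <-cmp x y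
... | tri< x<y _ _ = contradiction eq (<⇒≢ (rank-mono-< x∈s x<y))
... | tri≈ _ x≡y _ = x≡y
... | tri> _ _ y<x = contradiction (sym eq) (<⇒≢ (rank-mono-< y∈s y<x))

st-map : ∀ (f : ℕ → ℕ) w → (∀ {x y} → x ∈ w → y ∈ w → f x < f y ⇔ x < y) → st (map f w) ≡ st w
st-map f w mono = trans (sym (map-∘ w)) (map-cong-local (All.tabulate λ {x} x∈w →
  cong suc (trans (count-map (T? ∘ (_<ᵇ f x)) f w)
    (cong length (filter-cong-local _ _ {w} (All.tabulate λ {y} y∈w → mk⇔
      (<⇒<ᵇ ∘ Equivalence.to (mono y∈w x∈w) ∘ <ᵇ⇒< (f y) (f x))
      (<⇒<ᵇ ∘ Equivalence.from (mono y∈w x∈w) ∘ <ᵇ⇒< y x)))))))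

st-unique : ∀ {s} → Unique s → Unique (st s)
st-unique {s} us = go us id
  where
  go : ∀ {t} → Unique t → t ⊆ s → Unique (map (rank s) t)
  go [] _ = []
  go (x∉t ∷ ut) sub =
    All.map⁺ (All.tabulate λ y∈t eq →
      All.lookup x∉t y∈t (rank-injective (sub (here refl)) (sub (there y∈t)) eq))
    ∷ go ut (sub ∘ there)

-- Pigeonhole: the ranks are distinct, lie between 1 and the length, and are as many as the length.
-- This supplies the permutations to which `NoSelfOverlaps` is applied.
st-IsPerm : ∀ {s} → Unique s → IsPerm (length (st s)) (st s)
st-IsPerm {s} us = ↭⇒IsPerm (length (st s)) (↭-sym (unique⊆⇒↭ (st-unique us) sub
  (≤-reflexive (length-applyUpTo suc (length (st s))))))
  where
  sub : st s ⊆ range (length (st s))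
  sub r∈ with x , x∈s , refl ← ∈-map⁻ (rank s) r∈ =
    ∈-applyUpTo⁺ suc (subst (rank s x ≤_) (sym (length-st s)) (rank-≤-length x∈s))

-- Occurrences

window : ℕ → ℕ → List ℕ → List ℕ
window k i s = take k (drop i s)

window-⊆ : ∀ k i s → window k i s ⊆ s
window-⊆ k i s = All.lookup (All.take⁺ k (All.drop⁺ i (All.tabulate id)))

-- On the entries of `s` the map `rank s` preserves and reflects order, so a window keeps its
-- pattern. Occurrences in a segment thus carry over to its standardization.
st-window-st : ∀ k i s → st (window k i (st s)) ≡ st (window k i s)
st-window-st k i s = trans
  (cong st (trans (cong (take k) (drop-map i s)) (take-map k (drop i s))))
  (st-map (rank s) (window k i s) λ x∈ _ →
    mk⇔ (rank-cancel-< {s}) (rank-mono-< (window-⊆ k i s x∈)))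

-- Positions count from 0.
OccursAt : List ℕ → ℕ → List ℕ → Set
OccursAt τ i σ = st (window (length τ) i σ) ≡ τ

occursAt? : ∀ τ i → Decidable (OccursAt τ i)
occursAt? τ i σ = List.≡-dec _≟_ (st (window (length τ) i σ)) τ

suffixes≡ : ∀ s → suffixes s ≡ applyUpTo (λ i → drop i s) (suc (length s))
suffixes≡ []      = refl
suffixes≡ (x ∷ s) = cong ((x ∷ s) ∷_) (suffixes≡ s)

occ≡hits : ∀ τ σ → occ τ σ ≡ Hits.hits (occursAt? τ) (upTo (suc (length σ))) σ
occ≡hits τ σ = begin
  occ τ σ
    ≡⟨ cong length (filter-filter is-τ? (λ w → T? (length w ≡ᵇ k)) (λ {w} → len w) (map (take k) (suffixes σ))) ⟩
  count is-τ? (map (take k) (suffixes σ))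
    ≡⟨ cong (count is-τ? ∘ map (take k)) (trans (suffixes≡ σ) (sym (List.map-upTo (λ i → drop i σ) (suc (length σ))))) ⟩
  count is-τ? (map (take k) (map (λ i → drop i σ) (upTo (suc (length σ)))))
    ≡⟨ count-map is-τ? (take k) (map (λ i → drop i σ) (upTo (suc (length σ)))) ⟩
  count (is-τ? ∘ take k) (map (λ i → drop i σ) (upTo (suc (length σ))))
    ≡⟨ count-map (is-τ? ∘ take k) (λ i → drop i σ) (upTo (suc (length σ))) ⟩
  Hits.hits (occursAt? τ) (upTo (suc (length σ))) σ ∎
  where
  open ≡-Reasoning
  k = length τ
  is-τ? : Decidable (λ w → st w ≡ τ)
  is-τ? w = List.≡-dec _≟_ (st w) τ
  len : ∀ w → st w ≡ τ → T (length w ≡ᵇ k)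
  len w eq = ≡⇒≡ᵇ (length w) k (trans (sym (length-st w)) (cong length eq))

OccursAt⇒length : ∀ τ i {σ} → OccursAt τ i σ → length (window (length τ) i σ) ≡ length τ
OccursAt⇒length τ i {σ} o = trans (sym (length-st (window (length τ) i σ))) (cong length o)

OccursAt⇒≤ : ∀ τ i {σ} → OccursAt τ i σ → length τ ≤ length σ ∸ i
OccursAt⇒≤ τ i {σ} o = subst₂ _≤_ (OccursAt⇒length τ i {σ} o) (length-drop i σ)
  (subst (_≤ length (drop i σ)) (sym (length-take (length τ) (drop i σ))) (m⊓n≤n _ _))

-- Past the end the truncated difference `length σ ∸ i` is 0, while `τ` is nonempty.
OccursAt⇒position : ∀ {m} τ i {σ} → length τ ≡ suc m → OccursAt τ i σ → i ≤ length σ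
OccursAt⇒position τ i {σ} |τ| o = ≮⇒≥ λ lt → contradiction (OccursAt⇒≤ τ i {σ} o)
  (<⇒≱ (subst₂ _<_ (sym (m≤n⇒m∸n≡0 (<⇒≤ lt))) (sym |τ|) (s≤s z≤n)))

1<occ : ∀ τ {i j σ} → i ≤ length σ → j ≤ length σ → i ≢ j → OccursAt τ i σ → OccursAt τ j σ → 2 ≤ occ τ σ
1<occ τ {i} {j} {σ} i≤ j≤ i≢j oi oj = subst (2 ≤_) (sym (occ≡hits τ σ))
  (unique⊆⇒length≤ {xs = i ∷ j ∷ []} ((i≢j ∷ []) ∷ [] ∷ []) λ where
    (here refl)         → ∈-filter⁺ (λ l → occursAt? τ l σ) (∈-upTo⁺ (s≤s i≤)) oi
    (there (here refl)) → ∈-filter⁺ (λ l → occursAt? τ l σ) (∈-upTo⁺ (s≤s j≤)) oj)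

-- Two occurrences closer than `m` fit in a segment of length at most `2 * m`. Its standardization
-- is a permutation with two occurrences of `τ`, at 0 and at `d`, contrary to `NoSelfOverlaps`.
no-overlap : ∀ m {τ σ i j} → length τ ≡ suc m → NoSelfOverlaps m τ → Unique σ →
  i < j → OccursAt τ i σ → OccursAt τ j σ → i + m ≤ j
no-overlap m {τ} {σ} {i} {j} |τ| nso uσ i<j oi oj with i + m ≤? j
... | yes i+m≤j = i+m≤j
... | no i+m≰j = contradiction
  (1<occ τ z≤n (OccursAt⇒position τ d |τ| o-d) (<⇒≢ (m<n⇒0<n∸m i<j)) o₀ o-d)
  (<⇒≱ (s≤s (nso (st u) (st-IsPerm (Unique.take⁺ (d + k) (Unique.drop⁺ i uσ))) short)))
  where
  k = length τ
  d = j ∸ i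
  -- The shortest segment covering both windows: `d` entries before position `j`, then the window at
  -- `j`.
  u = take (d + k) (drop i σ)
  i+d : i + d ≡ j
  i+d = m+[n∸m]≡n (<⇒≤ i<j)
  d<m : d < m
  d<m = +-cancelˡ-< i d m (subst (_< i + m) (sym i+d) (≰⇒> i+m≰j))
  window₀ : window k 0 u ≡ window k i σ
  window₀ = trans (take-take k (d + k) (drop i σ))
    (cong (λ l → take l (drop i σ)) (m≤n⇒m⊓n≡m (m≤n+m k d)))
  window-d : window k d u ≡ window k j σ
  window-d = trans shifted (cong (take k) (trans (drop-drop i d σ) (cong (λ l → drop l σ) i+d)))
    where
    shifted : take k (drop d (take (d + k) (drop i σ))) ≡ take k (drop d (drop i σ))
    shifted = trans (cong (take k) (sym (take-drop k d (drop i σ))))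
      (trans (take-take k k _) (cong (λ l → take l (drop d (drop i σ))) (⊓-idem k)))
  o₀ : OccursAt τ 0 (st u)
  o₀ = trans (st-window-st k 0 u) (trans (cong st window₀) oi)
  o-d : OccursAt τ d (st u)
  o-d = trans (st-window-st k d u) (trans (cong st window-d) oj)
  short : length (st u) ≤ 2 * m
  short = begin
    length (st u)                     ≡⟨ length-st u ⟩
    length u                          ≡⟨ length-take (d + k) (drop i σ) ⟩
    (d + k) ⊓ length (drop i σ)       ≤⟨ m⊓n≤m _ _ ⟩
    d + k                             ≡⟨ cong (d +_) |τ| ⟩
    d + suc m                         ≡⟨ +-suc d m ⟩
    -- The strict inequality `d < m` pays for the extra entry in the pattern length `suc m`.
    suc d + m                         ≤⟨ +-monoˡ-≤ m d<m ⟩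
    m + m                             ≡⟨ cong (m +_) (+-identityʳ m) ⟨
    2 * m                             ∎
    where open ≤-Reasoning

drop-++ : (xs ys : List ℕ) → drop (length xs) (xs ++ ys) ≡ ys
drop-++ []       ys = refl
drop-++ (x ∷ xs) ys = drop-++ xs ys

take-++ : (xs ys : List ℕ) → take (length xs) (xs ++ ys) ≡ xs
take-++ []       ys = refl
take-++ (x ∷ xs) ys = cong (x ∷_) (take-++ xs ys)

window-++ˡ : ∀ k i xs {ys zs} → i + k ≤ length xs → window k i (xs ++ ys) ≡ window k i (xs ++ zs)
window-++ˡ zero    zero    xs       _       = refl
window-++ˡ (suc k) zero    (x ∷ xs) (s≤s h) = cong (x ∷_) (window-++ˡ k zero xs h)
window-++ˡ k       (suc i) (x ∷ xs) (s≤s h) = window-++ˡ k i xs h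

drop-++ʳ : ∀ i {xs ys : List ℕ} zs → length xs ≡ length ys → length xs ≤ i →
  drop i (xs ++ zs) ≡ drop i (ys ++ zs)
drop-++ʳ i {[]} {[]} zs _ _ = refl
drop-++ʳ (suc i) {x ∷ xs} {y ∷ ys} zs eq (s≤s h) = drop-++ʳ i zs (suc-injective eq) h

-- Rearranging windows

-- The value at the position of v in the list of keys; 0 if v is not a key.
assoc : List ℕ → List ℕ → ℕ → ℕ
assoc (k ∷ ks) (x ∷ xs) v with v ≟ k
... | yes _ = x
... | no  _ = assoc ks xs v
assoc _ _ _ = 0

assoc-map : ∀ (f : ℕ → ℕ) {ks v} → v ∈ ks → assoc ks (map f ks) v ≡ f v
assoc-map f {k ∷ ks} {v} v∈ with v ≟ k | v∈
... | yes refl | _          = refl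
... | no v≢k   | here v≡k   = contradiction v≡k v≢k
... | no _     | there v∈ks = assoc-map f v∈ks

map-assoc : ∀ {ks xs} → Unique ks → length ks ≡ length xs → map (assoc ks xs) ks ≡ xs
map-assoc {[]}     {[]}     []        _  = refl
map-assoc {k ∷ ks} {x ∷ xs} (k∉ ∷ uks) eq = cong₂ _∷_ at-head
  (trans (map-cong-local (All.map at-tail k∉)) (map-assoc uks (suc-injective eq)))
  where
  at-head : assoc (k ∷ ks) (x ∷ xs) k ≡ x
  at-head with k ≟ k
  ... | yes _  = refl
  ... | no k≢k = contradiction refl k≢k
  at-tail : ∀ {v} → k ≢ v → assoc (k ∷ ks) (x ∷ xs) v ≡ assoc ks xs v
  at-tail {v} k≢v with v ≟ k
  ... | yes v≡k = contradiction (sym v≡k) k≢v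
  ... | no _    = refl

map-cong⁻ : ∀ {f g : ℕ → ℕ} {xs x} → map f xs ≡ map g xs → x ∈ xs → f x ≡ g x
map-cong⁻ eq (here refl) = List.∷-injectiveˡ eq
map-cong⁻ eq (there x∈)  = map-cong⁻ (List.∷-injectiveʳ eq) x∈

-- If `st w ≡ τ`, then `assoc τ w` sends each rank to the entry of `w` having that rank; reading it
-- along `τ′` lists the same entries in the order `τ′`.
rearrange : List ℕ → List ℕ → List ℕ → List ℕ
rearrange τ τ′ w = map (assoc τ w) τ′

module _ {τ τ′ w : List ℕ} (uτ : Unique τ) (τ↭τ′ : τ ↭ τ′) (st-w : st w ≡ τ) where

  map-assoc-st : map (assoc τ w) τ ≡ w
  map-assoc-st = map-assoc uτ (trans (cong length (sym st-w)) (length-st w))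

  rearrange-↭ : rearrange τ τ′ w ↭ w
  rearrange-↭ = ↭-trans (↭-map⁺ _ (↭-sym τ↭τ′)) (↭-reflexive map-assoc-st)

  -- Mapping `rank w ∘ assoc τ w` over `τ` passes through `w` to `st w`, which is `τ` again;
  -- equality of the mapped lists is then read off entry by entry.
  rank-assoc : ∀ {v} → v ∈ τ → rank w (assoc τ w v) ≡ v
  rank-assoc = map-cong⁻ (begin
    map (rank w ∘ assoc τ w) τ       ≡⟨ map-∘ τ ⟩
    map (rank w) (map (assoc τ w) τ) ≡⟨ cong (map (rank w)) map-assoc-st ⟩
    st w                             ≡⟨ st-w ⟩
    τ                                ≡⟨ List.map-id τ ⟨
    map id τ                         ∎)
    where open ≡-Reasoning

  -- Ranks depend only on the set of entries, so those in the rearranged window are still given by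
  -- `rank w`, which undoes `assoc τ w`.
  st-rearrange : st (rearrange τ τ′ w) ≡ τ′
  st-rearrange = trans (sym (map-∘ τ′)) (map-id-local (All.tabulate λ {v} v∈τ′ →
    trans (rank-↭ rearrange-↭ (assoc τ w v)) (rank-assoc (∈-resp-↭ (↭-sym τ↭τ′) v∈τ′))))

  -- The rearranged window pairs each key `v` of `τ′` with `assoc τ w v`, so looking keys up in it
  -- is again `assoc τ w`; along `τ` this spells out `w`.
  rearrange-inverse : rearrange τ′ τ (rearrange τ τ′ w) ≡ w
  rearrange-inverse = trans
    (map-cong-local (All.tabulate λ v∈τ → assoc-map (assoc τ w) (∈-resp-↭ τ↭τ′ v∈τ)))
    map-assoc-st

last-∷ʳ : ∀ (s : List ℕ) a → last (s ∷ʳ a) ≡ just a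
last-∷ʳ []          a = refl
last-∷ʳ (x ∷ [])    a = refl
last-∷ʳ (x ∷ y ∷ s) a = last-∷ʳ (y ∷ s) a

-- The distance is `m`, not `suc m`: windows of length `suc m` may still share one entry, the last
-- of one and the first of the other.
Spaced : ℕ → ℕ → ℕ → Set
Spaced m i j = i + m ≤ j ⊎ j + m ≤ i

-- A window starting at distance at least m from i meets the segment of length m + 1 at i
-- at most in its first or last entry.
window-far : ∀ m (g : ℕ → ℕ) {τ τ′} xs ys {j} → length τ ≡ suc m → length τ′ ≡ suc m →
  head τ ≡ head τ′ → last τ ≡ last τ′ → Spaced m (length xs) j →
  window (suc m) j (xs ++ map g τ ++ ys) ≡ window (suc m) j (xs ++ map g τ′ ++ ys)
window-far m g {a ∷ t} {b ∷ t′} xs ys {j} |τ| |τ′| hd _ (inj₂ j+m≤i)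
  with refl ← just-injective hd = begin
  window (suc m) j (xs ++ map g (a ∷ t) ++ ys)
    ≡⟨ cong (window (suc m) j) (++-assoc xs [ g a ] _) ⟨
  -- The window may reach index `length xs` but no further, so the common first entry is moved into
  -- the prefix.
  window (suc m) j ((xs ∷ʳ g a) ++ (map g t ++ ys))
    ≡⟨ window-++ˡ (suc m) j (xs ∷ʳ g a) bound ⟩
  window (suc m) j ((xs ∷ʳ g a) ++ (map g t′ ++ ys))
    ≡⟨ cong (window (suc m) j) (++-assoc xs [ g a ] _) ⟩
  window (suc m) j (xs ++ map g (a ∷ t′) ++ ys) ∎
  where
  open ≡-Reasoning
  bound : j + suc m ≤ length (xs ∷ʳ g a)
  bound = subst₂ _≤_ (sym (+-suc j m)) (sym (trans (length-++ xs) (+-comm _ 1))) (s≤s j+m≤i)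
window-far m g {τ} {τ′} xs ys {j} |τ| |τ′| _ lst (inj₁ i+m≤j)
  with initLast τ | initLast τ′
window-far m g xs ys {j} () _ _ _ (inj₁ _) | [] | _
window-far m g xs ys {j} _ () _ _ (inj₁ _) | _ ∷ʳ′ _ | []
window-far m g xs ys {j} |τ| |τ′| _ lst (inj₁ i+m≤j) | s ∷ʳ′ a | s′ ∷ʳ′ b
  with refl ← just-injective (trans (sym (last-∷ʳ s a)) (trans lst (last-∷ʳ s′ b))) =
  cong (take (suc m)) (begin
    drop j (xs ++ map g (s ∷ʳ a) ++ ys)   ≡⟨ cong (drop j) (regroup s) ⟩
    -- Here the window starts no earlier than the common last entry, which is moved into the suffix;
    -- everything before it is dropped.
    drop j ((xs ++ map g s) ++ g a ∷ ys)  ≡⟨ drop-++ʳ j (g a ∷ ys) (trans (len s |τ|) (sym (len s′ |τ′|)))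
                                               (subst (_≤ j) (sym (len s |τ|)) i+m≤j) ⟩
    drop j ((xs ++ map g s′) ++ g a ∷ ys) ≡⟨ cong (drop j) (regroup s′) ⟨
    drop j (xs ++ map g (s′ ∷ʳ a) ++ ys)  ∎)
  where
  open ≡-Reasoning
  regroup : ∀ s → xs ++ map g (s ∷ʳ a) ++ ys ≡ (xs ++ map g s) ++ g a ∷ ys
  regroup s = begin
    xs ++ map g (s ∷ʳ a) ++ ys       ≡⟨ cong (λ l → xs ++ l ++ ys) (map-++ g s [ a ]) ⟩
    xs ++ (map g s ∷ʳ g a) ++ ys     ≡⟨ cong (xs ++_) (++-assoc (map g s) [ g a ] ys) ⟩
    xs ++ map g s ++ g a ∷ ys        ≡⟨ ++-assoc xs (map g s) (g a ∷ ys) ⟨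
    (xs ++ map g s) ++ g a ∷ ys      ∎
  len : ∀ s → length (s ∷ʳ a) ≡ suc m → length (xs ++ map g s) ≡ length xs + m
  len s eq = trans (length-++ xs) (cong (length xs +_) (trans (length-map g s)
    (suc-injective (trans (+-comm 1 _) (trans (sym (length-++ s)) eq)))))

-- Replacing one window of a permutation

splice : ℕ → List ℕ → List ℕ → ℕ → List ℕ → List ℕ
splice k τ τ′ i σ = take i σ ++ rearrange τ τ′ (window k i σ) ++ drop k (drop i σ)

module _ {k i : ℕ} (xs w ys : List ℕ) (|xs| : length xs ≡ i) (|w| : length w ≡ k) where

  private
    σ = xs ++ w ++ ys

  take-split : take i σ ≡ xs
  take-split = trans (cong (λ l → take l σ) (sym |xs|)) (take-++ xs (w ++ ys))

  drop-split : drop i σ ≡ w ++ ys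
  drop-split = trans (cong (λ l → drop l σ) (sym |xs|)) (drop-++ xs (w ++ ys))

  window-split : window k i σ ≡ w
  window-split = trans (cong₂ take (sym |w|) drop-split) (take-++ w ys)

  drop-drop-split : drop k (drop i σ) ≡ ys
  drop-drop-split = trans (cong₂ drop (sym |w|) drop-split) (drop-++ w ys)

  splice-split : ∀ τ τ′ → splice k τ τ′ i σ ≡ xs ++ rearrange τ τ′ w ++ ys
  splice-split τ τ′ = cong₂ _++_ take-split
    (cong₂ _++_ (cong (rearrange τ τ′) window-split) drop-drop-split)

module Exchange (m : ℕ) {τ τ′ : List ℕ} (|τ| : length τ ≡ suc m) (|τ′| : length τ′ ≡ suc m)
  (uτ : Unique τ) (τ↭τ′ : τ ↭ τ′) (hd : head τ ≡ head τ′) (lst : last τ ≡ last τ′) where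

  module _ {i σ} (o : OccursAt τ i σ) where

    private
      k = suc m
      xs = take i σ
      w  = window k i σ
      ys = drop k (drop i σ)

      st-w : st w ≡ τ
      st-w = subst (λ l → st (window l i σ) ≡ τ) |τ| o

      |w| : length w ≡ k
      |w| = trans (sym (length-st w)) (trans (cong length st-w) |τ|)

      |xs| : length xs ≡ i
      |xs| = trans (length-take i σ) (m≤n⇒m⊓n≡m (OccursAt⇒position τ i |τ| o))

      σ≡ : xs ++ w ++ ys ≡ σ
      σ≡ = trans (cong (xs ++_) (take++drop≡id k (drop i σ))) (take++drop≡id i σ)

      |w′| : length (rearrange τ τ′ w) ≡ k
      |w′| = trans (length-map _ τ′) |τ′|

    splice-↭ : splice k τ τ′ i σ ↭ σ
    splice-↭ = ↭-trans (++⁺ˡ xs (++⁺ʳ ys (rearrange-↭ uτ τ↭τ′ st-w))) (↭-reflexive σ≡)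

    splice-occurs : OccursAt τ′ i (splice k τ τ′ i σ)
    splice-occurs = subst (λ l → st (window l i (splice k τ τ′ i σ)) ≡ τ′) (sym |τ′|)
      (trans (cong st (window-split xs (rearrange τ τ′ w) ys |xs| |w′|)) (st-rearrange uτ τ↭τ′ st-w))

    splice-inverse : splice k τ′ τ i (splice k τ τ′ i σ) ≡ σ
    splice-inverse = trans (splice-split xs (rearrange τ τ′ w) ys |xs| |w′| τ′ τ)
      (trans (cong (λ v → xs ++ v ++ ys) (rearrange-inverse uτ τ↭τ′ st-w)) σ≡)

    -- With `g = assoc τ w`, the old window is `map g τ` and the new one is `map g τ′`, so
    -- `window-far` compares the two lists.
    window-splice : ∀ {j} → Spaced m i j → window k j (splice k τ τ′ i σ) ≡ window k j σ
    window-splice {j} sp = begin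
      window k j (xs ++ map (assoc τ w) τ′ ++ ys)
        ≡⟨ window-far m (assoc τ w) xs ys |τ| |τ′| hd lst (subst (λ l → Spaced m l j) (sym |xs|) sp) ⟨
      window k j (xs ++ map (assoc τ w) τ ++ ys)
        ≡⟨ cong (λ v → window k j (xs ++ v ++ ys)) (map-assoc-st uτ τ↭τ′ st-w) ⟩
      window k j (xs ++ w ++ ys)
        ≡⟨ cong (window k j) σ≡ ⟩
      window k j σ ∎
      where open ≡-Reasoning

    -- The pattern `π` is left free because other marked positions may carry either `τ` or `τ′`.
    splice-preserves : ∀ {π j} → length π ≡ suc m → Spaced m i j →
      OccursAt π j σ → OccursAt π j (splice k τ τ′ i σ)
    splice-preserves {π} {j} |π| sp =
      subst (λ l → st (window l j σ) ≡ π → st (window l j (splice k τ τ′ i σ)) ≡ π) (sym |π|)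
        (trans (cong st (window-splice sp)))

  module _ {P : List ℕ → Set} (P? : Decidable P) {i : ℕ}
    (pres : ∀ {σ} → OccursAt τ i σ → P σ → P (splice (suc m) τ τ′ i σ)) where

    -- Splicing at `i` is undone by splicing back, so it is injective on the permutations counted on
    -- the left. The reverse inequality comes from exchanging the roles of `τ` and `τ′`.
    exchange-≤ : ∀ n → count (λ σ → occursAt? τ i σ ×-dec P? σ) (perms n) ≤
      count (λ σ → occursAt? τ′ i σ ×-dec P? σ) (perms n)
    exchange-≤ n = count-≤ _ _ (perms-unique n) (splice (suc m) τ τ′ i) (splice (suc m) τ′ τ i)
      λ {σ} σ∈ (o , p) →
        ∈-perms⁺ n (↭-trans (splice-↭ {i} {σ} o) (∈-perms⁻ n σ∈)) ,
        (splice-occurs {i} {σ} o , pres o p) ,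
        splice-inverse {i} {σ} o

-- Counting permutations with marked occurrences

module _ (m : ℕ) {τ τ′ : List ℕ} (|τ| : length τ ≡ suc m) (|τ′| : length τ′ ≡ suc m)
  (uτ : Unique τ) (τ↭τ′ : τ ↭ τ′) (hd : head τ ≡ head τ′) (lst : last τ ≡ last τ′) where

  private
    module M = Hits (occursAt? τ)
    module M′ = Hits (occursAt? τ′)
    module E = Exchange m |τ| |τ′| uτ τ↭τ′ hd lst
    module E′ = Exchange m |τ′| |τ| (unique-↭ τ↭τ′ uτ) (↭-sym τ↭τ′) (sym hd) (sym lst)

  -- Positions pass one at a time from `S`, where `τ` is still required, to `S′`, where `τ′` already
  -- is. A general `S′` is what the induction needs.
  count-spaced : ∀ n S S′ → AllPairs (Spaced m) (S ++ S′) →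
    count (λ σ → M.all-hit? S σ ×-dec M′.all-hit? S′ σ) (perms n) ≡
    count (λ σ → M′.all-hit? S σ ×-dec M′.all-hit? S′ σ) (perms n)
  count-spaced n [] S′ _ = count-cong _ _ (perms n) (λ (_ , p) → [] , p) (λ (_ , p) → [] , p)
  count-spaced n (i ∷ S) S′ sp@(far ∷ _) = begin
    count (λ σ → M.all-hit? (i ∷ S) σ ×-dec M′.all-hit? S′ σ) (perms n)
      ≡⟨ count-cong _ _ (perms n) (λ { (o ∷ p , q) → o , p , q }) (λ (o , p , q) → o ∷ p , q) ⟩
    count (λ σ → occursAt? τ i σ ×-dec rest? σ) (perms n)
      -- Position `i` is spaced from all of `S` and `S′`, so splicing there, in either direction,
      -- keeps every other requirement.
      ≡⟨ ≤-antisym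
           (E.exchange-≤ rest? {i} (λ {σ} o (p , q) →
             All.zipWith (λ {j} (f , h) → E.splice-preserves {i} {σ} o {τ} {j} |τ| f h) (farS , p) ,
             All.zipWith (λ {j} (f , h) → E.splice-preserves {i} {σ} o {τ′} {j} |τ′| f h) (farS′ , q)) n)
           (E′.exchange-≤ rest? {i} (λ {σ} o (p , q) →
             All.zipWith (λ {j} (f , h) → E′.splice-preserves {i} {σ} o {τ} {j} |τ| f h) (farS , p) ,
             All.zipWith (λ {j} (f , h) → E′.splice-preserves {i} {σ} o {τ′} {j} |τ′| f h) (farS′ , q)) n) ⟩
    count (λ σ → occursAt? τ′ i σ ×-dec rest? σ) (perms n)
      ≡⟨ count-cong _ _ (perms n) (λ (o , p , q) → p , o ∷ q) (λ { (p , o ∷ q) → o , p , q }) ⟩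
    count (λ σ → M.all-hit? S σ ×-dec M′.all-hit? (i ∷ S′) σ) (perms n)
      -- Moving `i` across only permutes `S ++ S′`, and `Spaced m` is symmetric, so pairwise spacing
      -- survives.
      ≡⟨ count-spaced n S (i ∷ S′) (AllPairs-resp-↭ (setoid ℕ) swap (resp₂ (Spaced m)) (↭⇒↭ₛ (↭-sym (shift i S S′))) sp) ⟩
    count (λ σ → M′.all-hit? S σ ×-dec M′.all-hit? (i ∷ S′) σ) (perms n)
      ≡⟨ count-cong _ _ (perms n) (λ { (p , o ∷ q) → o ∷ p , q }) (λ { (o ∷ p , q) → p , o ∷ q }) ⟩
    count (λ σ → M′.all-hit? (i ∷ S) σ ×-dec M′.all-hit? S′ σ) (perms n) ∎
    where
    open ≡-Reasoning
    rest? = λ σ → M.all-hit? S σ ×-dec M′.all-hit? S′ σ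
    farS  = All.++⁻ˡ S far
    farS′ = All.++⁻ʳ S far

spaced? : ∀ m i j → Dec (Spaced m i j)
spaced? m i j = i + m ≤? j ⊎-dec j + m ≤? i

occurrences-spaced : ∀ m {τ σ S} → length τ ≡ suc m → NoSelfOverlaps m τ → Unique σ →
  Unique S → All (λ i → OccursAt τ i σ) S → AllPairs (Spaced m) S
occurrences-spaced m |τ| nso uσ [] [] = []
occurrences-spaced m {τ} {σ} |τ| nso uσ (i∉S ∷ uS) (oi ∷ oS) =
  All.zipWith (λ (i≢j , oj) → apart i≢j oi oj) (i∉S , oS) ∷ occurrences-spaced m {τ} |τ| nso uσ uS oS
  where
  apart : ∀ {i j} → i ≢ j → OccursAt τ i σ → OccursAt τ j σ → Spaced m i j
  apart {i} {j} i≢j oi oj with <-cmp i j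
  ... | tri< i<j _ _ = inj₁ (no-overlap m {τ} |τ| nso uσ i<j oi oj)
  ... | tri≈ _ i≡j _ = contradiction i≡j i≢j
  ... | tri> _ _ j<i = inj₂ (no-overlap m {τ} |τ| nso uσ j<i oj oi)

-- If the positions are pairwise spaced, all of them are exchanged. Otherwise both counts are 0,
-- since occurrences of a pattern without self-overlaps are always spaced.
count-occurring : ∀ m {τ τ′} → length τ ≡ suc m → length τ′ ≡ suc m → Unique τ → τ ↭ τ′ →
  NoSelfOverlaps m τ → NoSelfOverlaps m τ′ → head τ ≡ head τ′ → last τ ≡ last τ′ →
  ∀ n S → Unique S →
  count (Hits.all-hit? (occursAt? τ) S) (perms n) ≡ count (Hits.all-hit? (occursAt? τ′) S) (perms n)
count-occurring m {τ} {τ′} |τ| |τ′| uτ τ↭τ′ nso nso′ hd lst n S uS with allPairs? (spaced? m) S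
... | yes sp = begin
  count (M.all-hit? S) (perms n)
    ≡⟨ count-cong _ _ (perms n) (_, []) proj₁ ⟩
  count (λ σ → M.all-hit? S σ ×-dec M′.all-hit? [] σ) (perms n)
    ≡⟨ count-spaced m |τ| |τ′| uτ τ↭τ′ hd lst n S [] (subst (AllPairs _) (sym (List.++-identityʳ S)) sp) ⟩
  count (λ σ → M′.all-hit? S σ ×-dec M′.all-hit? [] σ) (perms n)
    ≡⟨ count-cong _ _ (perms n) proj₁ (_, []) ⟩
  count (M′.all-hit? S) (perms n) ∎
  where
  open ≡-Reasoning
  module M = Hits (occursAt? τ)
  module M′ = Hits (occursAt? τ′)
... | no ¬sp = trans (none |τ| nso) (sym (none |τ′| nso′))
  where
  none : ∀ {π} → length π ≡ suc m → NoSelfOverlaps m π →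
    count (Hits.all-hit? (occursAt? π) S) (perms n) ≡ 0
  none {π} |π| nsoπ = count-none _ (perms n) λ σ∈ hit →
    ¬sp (occurrences-spaced m {π} |π| nsoπ (unique-↭ (↭-sym (∈-perms⁻ n σ∈)) (range-unique n)) uS hit)

-- Inclusion-exclusion needs one list of positions for all permutations; the list in `occ≡hits`
-- depends on `length σ`, which is `n` throughout `perms n`.
numExact≡count-hits : ∀ n τ k →
  numExact n τ k ≡ count (λ σ → Hits.hits (occursAt? τ) (upTo (suc n)) σ ≟ k) (perms n)
numExact≡count-hits n τ k = cong length (filter-cong-local _ _ (All.tabulate λ {σ} σ∈ →
  let eq = trans (occ≡hits τ σ) (cong (λ l → Hits.hits (occursAt? τ) (upTo (suc l)) σ)
             (trans (↭-length (∈-perms⁻ n σ∈)) (length-applyUpTo suc n)))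
  in mk⇔ (trans (sym eq)) (trans eq)))

mainTheorem4 : (m : ℕ) → 1 ≤ m → (τ τ′ : List ℕ) →
    IsPerm (suc m) τ → IsPerm (suc m) τ′ →
    NoSelfOverlaps m τ → NoSelfOverlaps m τ′ →
    head τ ≡ head τ′ → last τ ≡ last τ′ →
    (n k : ℕ) → numExact n τ k ≡ numExact n τ′ k
mainTheorem4 m _ τ τ′ perm perm′ nso nso′ hd lst n k = begin
  numExact n τ k
    ≡⟨ numExact≡count-hits n τ k ⟩
  count (λ σ → Hits.hits (occursAt? τ) (upTo (suc n)) σ ≟ k) (perms n)
    ≡⟨ count-hits (occursAt? τ) (occursAt? τ′) (perms n)
         (count-occurring m (len p) (len p′) (unique-↭ (↭-sym p) (range-unique (suc m)))
           (↭-trans p (↭-sym p′)) nso nso′ hd lst n)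
         (upTo (suc n)) (Unique.upTo⁺ (suc n)) k ⟩
  count (λ σ → Hits.hits (occursAt? τ′) (upTo (suc n)) σ ≟ k) (perms n)
    ≡⟨ numExact≡count-hits n τ′ k ⟨
  numExact n τ′ k ∎
  where
  open ≡-Reasoning
  p  = IsPerm⇒↭ (suc m) perm
  p′ = IsPerm⇒↭ (suc m) perm′
  len : ∀ {s} → s ↭ range (suc m) → length s ≡ suc m
  len q = trans (↭-length q) (length-applyUpTo suc (suc m))
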